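{- Let $S$ be one of CK, ID, MP, ID+MP, and let the corresponding conditional system be CK, CK+ID, CK+MP, CK+MP+ID respectively. If a formula $A$ is valid in the corresponding system, then the sequent $\vdash x:A$ ($x$ a label) is derivable in Seq$S$.
   Context: Formulas are built from propositional variables (a set $ATM$) and $\bot$ by the binary connectives $\to$ and $\Rightarrow$. Semantics. A (selection function) model is $\mathcal{M}=\langle \mathcal{W}, f, [\,]\rangle$ with $\mathcal{W}\neq\emptyset$ a set of worlds, $f:\mathcal{W}\times 2^{\mathcal{W}}\to 2^{\mathcal{W}}$, and $[\,]$ assigning to each $P\in ATM$ a subset $[P]\subseteq\mathcal{W}$, extended by $[\bot]=\emptyset$, $[A\to B]=(\mathcal{W}\setminus[A])\cup[B]$, $[A\Rightarrow B]=\{w\in\mathcal{W}: f(w,[A])\subseteq[B]\}$. System CK: all models. CK+ID: models with $f(w,[A])\subseteq[A]$ for all worlds $w$ and formulas $A$. CK+MP: models such that $w\in[A]$ implies $w\in f(w,[A])$ for all $w$, $A$. CK+MP+ID: models satisfying both conditions. A formula $A$ is valid in a system if $[A]=\mathcal{W}$ in every model of that system. Sequents. Fix a denumerable set $\mathcal{A}$ of labels. A labelled formula is $x:A$ and a transition formula is $x\xrightarrow{A}y$, with $x,y\in\mathcal{A}$ and $A$ a formula. A sequent $\Gamma\vdash\Delta$ is a pair of finite multisets of labelled and transition formulas. Calculus Seq$S$ ($F$ is any labelled or transition formula): (AX) axiom $\Gamma,F\vdash\Delta,F$. (A$\bot$) axiom $\Gamma,x:\bot\vdash\Delta$. (Weak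 L) from $\Gamma\vdash\Delta$ infer $\Gamma,F\vdash\Delta$. (Weak R) from $\Gamma\vdash\Delta$ infer $\Gamma\vdash\Delta,F$. (Contr L) from $\Gamma,F,F\vdash\Delta$ infer $\Gamma,F\vdash\Delta$. (Contr R) from $\Gamma\vdash\Delta,F,F$ infer $\Gamma\vdash\Delta,F$. ($\to$R) from $\Gamma,x:A\vdash x:B,\Delta$ infer $\Gamma\vdash x:A\to B,\Delta$. ($\to$L) from $\Gamma\vdash x:A,\Delta$ and $\Gamma,x:B\vdash\Delta$ infer $\Gamma,x:A\to B\vdash\Delta$. (EQ) from $u:A\vdash u:B$ and $u:B\vdash u:A$ infer $\Gamma,x\xrightarrow{A}y\vdash x\xrightarrow{B}y,\Delta$. ($\Rightarrow$L) from $\Gamma\vdash x\xrightarrow{A}y,\Delta$ and $\Gamma,y:B\vdash\Delta$ infer $\Gamma,x:A\Rightarrow B\vdash\Delta$. ($\Rightarrow$R) from $\Gamma,x\xrightarrow{A}y\vdash y:B,\Delta$ infer $\Gamma\vdash x:A\Rightarrow B,\Delta$, where the label $y$ does not occur in $\Gamma,\Delta$ and $y\neq x$. (ID) (only in SeqID and SeqID+MP) from $\Gamma,y:A\vdash\Delta$ infer $\Gamma,x\xrightarrow{A}y\vdash\Delta$. (MP) (only in SeqMP and SeqID+MP) from $\Gamma\vdash x:A,\Delta$ infer $\Gamma\vdash x\xrightarrow{A}x,\Delta$. -}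

module Defs where

open import Level using (0ℓ)
open import Data.Bool.Base using (Bool; true; false; T)
open import Data.List.Base using (List; []; _∷_)
open import Data.List.Relation.Binary.Permutation.Propositional using (_↭_)
open import Data.List.Relation.Unary.All using (All)
open import Data.Product.Base using (_×_)
open import Relation.Binary.PropositionalEquality using (_≢_)
open import Relation.Unary using (Pred; _∈_; _⊆_; _≐_; _∪_; ∁; ∅; Universal)

infixr 7 _⊃_ _⇒_
infix  6 _∶_ _—[_]→_
infix  3 _⊢[_]_
infix  4 _#_

-- `_⊃_` is the material implication → and `_⇒_` the conditional.

data Formula (ATM : Set) : Set where
  atom : ATM → Formula ATM
  ⊥′   : Formula ATM
  _⊃_  : Formula ATM → Formula ATM → Formula ATM
  _⇒_  : Formula ATM → Formula ATM → Formula ATM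

data System : Set where
  CK ID MP ID+MP : System

hasID : System → Bool
hasID CK    = false
hasID ID    = true
hasID MP    = false
hasID ID+MP = true

hasMP : System → Bool
hasMP CK    = false
hasMP ID    = false
hasMP MP    = true
hasMP ID+MP = true

-- Subsets are predicates, and equality of subsets is mutual inclusion `_≐_`.
-- The field `f-cong` says that f depends only on the subset it is given, not
-- on the predicate presenting 
record Model (ATM : Set) : Set₁ where
  field
    W        : Set
    nonempty : W
    f        : W → Pred W 0ℓ → Pred W 0ℓ
    f-cong   : ∀ w {X Y} → X ≐ Y → f w X ≐ f w Y
    val      : ATM → Pred W 0ℓ

  ⟦_⟧ : Formula ATM → Pred W 0ℓ
  ⟦ atom P ⟧ = val P
  ⟦ ⊥′ ⟧     = ∅
  ⟦ A ⊃ B ⟧  = ∁ ⟦ A ⟧ ∪ ⟦ B ⟧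
  ⟦ A ⇒ B ⟧  = λ w → f w ⟦ A ⟧ ⊆ ⟦ B ⟧

  IDCondition : Set
  IDCondition = ∀ w A → f w ⟦ A ⟧ ⊆ ⟦ A ⟧

  MPCondition : Set
  MPCondition = ∀ w A → w ∈ ⟦ A ⟧ → w ∈ f w ⟦ A ⟧

IsModelOf : {ATM : Set} → System → Model ATM → Set
IsModelOf S M = (T (hasID S) → IDCondition) × (T (hasMP S) → MPCondition)
  where open Model M

Valid : {ATM : Set} → System → Formula ATM → Set₁
Valid {ATM} S A = (M : Model ATM) → IsModelOf S M → Universal (Model.⟦_⟧ M A)

data SeqFormula (Label ATM : Set) : Set where
  _∶_     : Label → Formula ATM → SeqFormula Label ATM
  _—[_]→_ : Label → Formula ATM → Label → SeqFormula Label ATM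

_#_ : {Label ATM : Set} → Label → SeqFormula Label ATM → Set
y # (x ∶ A)       = y ≢ x
y # (x —[ A ]→ z) = y ≢ x × y ≢ z

-- `Γ ⊢[ S ] Δ` is derivability in SeqS. Finite multisets are represented by
-- lists up to permutation: the rules act at the head of the lists and `exch`
-- identifies lists that present the same multiset.

data _⊢[_]_ {Label ATM : Set} :
       List (SeqFormula Label ATM) → System → List (SeqFormula Label ATM) → Set where

  exch   : ∀ {S Γ Γ′ Δ Δ′} → Γ ↭ Γ′ → Δ ↭ Δ′ → Γ ⊢[ S ] Δ → Γ′ ⊢[ S ] Δ′

  AX     : ∀ {S Γ Δ F} → F ∷ Γ ⊢[ S ] F ∷ Δ
  A⊥     : ∀ {S Γ Δ x} → x ∶ ⊥′ ∷ Γ ⊢[ S ] Δ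

  WeakL  : ∀ {S Γ Δ F} → Γ ⊢[ S ] Δ → F ∷ Γ ⊢[ S ] Δ
  WeakR  : ∀ {S Γ Δ F} → Γ ⊢[ S ] Δ → Γ ⊢[ S ] F ∷ Δ
  ContrL : ∀ {S Γ Δ F} → F ∷ F ∷ Γ ⊢[ S ] Δ → F ∷ Γ ⊢[ S ] Δ
  ContrR : ∀ {S Γ Δ F} → Γ ⊢[ S ] F ∷ F ∷ Δ → Γ ⊢[ S ] F ∷ Δ

  ⊃R     : ∀ {S Γ Δ x A B} →
           x ∶ A ∷ Γ ⊢[ S ] x ∶ B ∷ Δ →
           Γ ⊢[ S ] x ∶ (A ⊃ B) ∷ Δ
  ⊃L     : ∀ {S Γ Δ x A B} →
           Γ ⊢[ S ] x ∶ A ∷ Δ →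
           x ∶ B ∷ Γ ⊢[ S ] Δ →
           x ∶ (A ⊃ B) ∷ Γ ⊢[ S ] Δ

  EQ     : ∀ {S Γ Δ x y A B} {u : Label} →
           u ∶ A ∷ [] ⊢[ S ] u ∶ B ∷ [] →
           u ∶ B ∷ [] ⊢[ S ] u ∶ A ∷ [] →
           x —[ A ]→ y ∷ Γ ⊢[ S ] x —[ B ]→ y ∷ Δ

  ⇒L     : ∀ {S Γ Δ x y A B} →
           Γ ⊢[ S ] x —[ A ]→ y ∷ Δ →
           y ∶ B ∷ Γ ⊢[ S ] Δ →
           x ∶ (A ⇒ B) ∷ Γ ⊢[ S ] Δ
  ⇒R     : ∀ {S Γ Δ x y A B} →
           All (y #_) Γ → All (y #_) Δ → y ≢ x →
           x —[ A ]→ y ∷ Γ ⊢[ S ] y ∶ B ∷ Δ →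
           Γ ⊢[ S ] x ∶ (A ⇒ B) ∷ Δ

  IDrule : ∀ {S Γ Δ x y A} → T (hasID S) →
           y ∶ A ∷ Γ ⊢[ S ] Δ →
           x —[ A ]→ y ∷ Γ ⊢[ S ] Δ
  MPrule : ∀ {S Γ Δ x A} → T (hasMP S) →
           Γ ⊢[ S ] x ∶ A ∷ Δ →
           Γ ⊢[ S ] x —[ A ]→ x ∷ Δ

{-# OPTIONS --safe #-}

-- Every underivable sequent is extended, in ω steps, to a pair (Γ, Δ) that is
-- saturated under the rules read bottom-up; backward contraction keeps the
-- principal formulas.  The worlds of the countermodel are the labels of all these
-- saturated pairs simultaneously, so two formulas A and B with equal extension
-- must satisfy u : A ⊢ u : B and u : B ⊢ u : A, as otherwise the saturation of
-- one of these sequents contains a world separating them; this is what (EQ)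
-- needs.

module Submission where

open import Level using (0ℓ)
open import Axiom.ExcludedMiddle using (ExcludedMiddle)
open import Data.Bool.Base using (T)
open import Data.List.Base using (List; []; _∷_; _++_; map; upTo; cartesianProduct)
open import Data.List.Membership.Propositional using (_∈_)
open import Data.List.Membership.Propositional.Properties
  using (∈-∃++; ∈-++⁺ʳ; ∈-map⁺; ∈-upTo⁺; ∈-cartesianProduct⁺; ∈-cartesianProduct⁻)
open import Data.List.Relation.Binary.Permutation.Propositional
  using (↭-refl; ↭-sym; prep)
open import Data.List.Relation.Binary.Permutation.Propositional.Properties using (shift; ++-comm)
open import Data.List.Relation.Binary.Subset.Propositional using (_⊆_)
open import Data.List.Relation.Unary.All as All using (All; []; _∷_)
open import Data.List.Relation.Unary.Any using (here; there)
open import Data.Nat.Base using (ℕ; zero; suc; _⊔_; _≤_; _≤′_; ≤′-refl; ≤′-step)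
open import Data.Nat.Properties
  using (≤-trans; ≤-reflexive; m≤m⊔n; m≤n⊔m; 1+n≰n; ≤⇒≤′; m⊔n≤o⇒m≤o; m⊔n≤o⇒n≤o)
open import Data.Product.Base using (∃; _×_; _,_; proj₁; proj₂)
open import Data.Sum.Base as Sum using (_⊎_; inj₁; inj₂; [_,_]′)
open import Data.Unit.Base using (⊤; tt)
open import Function.Base using (_∘_; id)
open import Function.Bundles using (_↔_; Inverse)
open import Relation.Binary.PropositionalEquality using (_≡_; refl; sym; subst)
open import Relation.Nullary using (¬_; yes; no; contradiction; decidable-stable)
import Relation.Unary as U
open import Defs

-- Structural rules up to list inclusion.

module _ {Label ATM : Set} {S : System} where

  private
    variable
      Γ Γ′ Δ Δ′ : List (SeqFormula Label ATM)
      F : SeqFormula Label ATM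

  contractL : F ∈ Γ → F ∷ Γ ⊢[ S ] Δ → Γ ⊢[ S ] Δ
  contractL {F = F} F∈Γ d with ∈-∃++ F∈Γ
  ... | Γ₁ , Γ₂ , refl =
    exch (↭-sym (shift F Γ₁ Γ₂)) ↭-refl (ContrL (exch (prep F (shift F Γ₁ Γ₂)) ↭-refl d))

  contractR : F ∈ Δ → Γ ⊢[ S ] F ∷ Δ → Γ ⊢[ S ] Δ
  contractR {F = F} F∈Δ d with ∈-∃++ F∈Δ
  ... | Δ₁ , Δ₂ , refl =
    exch ↭-refl (↭-sym (shift F Δ₁ Δ₂)) (ContrR (exch ↭-refl (prep F (shift F Δ₁ Δ₂)) d))

  weaken-++ : ∀ Γ′ Δ′ → Γ ⊢[ S ] Δ → Γ′ ++ Γ ⊢[ S ] Δ′ ++ Δ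
  weaken-++ []       []       d = d
  weaken-++ []       (F ∷ Δ′) d = WeakR (weaken-++ [] Δ′ d)
  weaken-++ (F ∷ Γ′) Δ′       d = WeakL (weaken-++ Γ′ Δ′ d)

  contract-++ : ∀ Γ Δ → Γ ⊆ Γ′ → Δ ⊆ Δ′ → Γ ++ Γ′ ⊢[ S ] Δ ++ Δ′ → Γ′ ⊢[ S ] Δ′
  contract-++ []      []      p q d = d
  contract-++ []      (F ∷ Δ) p q d =
    contract-++ [] Δ p (q ∘ there) (contractR (∈-++⁺ʳ Δ (q (here refl))) d)
  contract-++ (F ∷ Γ) Δ       p q d =
    contract-++ Γ Δ (p ∘ there) q (contractL (∈-++⁺ʳ Γ (p (here refl))) d)

  -- Weakening by all of `Γ′` and `Δ′` and then contracting `Γ` and `Δ` into them avoids computing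
  -- complements.
  ⊢-⊆ : Γ ⊆ Γ′ → Δ ⊆ Δ′ → Γ ⊢[ S ] Δ → Γ′ ⊢[ S ] Δ′
  ⊢-⊆ {Γ} {Γ′} {Δ} {Δ′} p q d =
    contract-++ Γ Δ p q (exch (++-comm Γ′ Γ) (++-comm Δ′ Δ) (weaken-++ Γ′ Δ′ d))

-- Signed sequents and fresh labels.

module Canonical (em : ExcludedMiddle 0ℓ) {ATM Label : Set} (Label↔ℕ : Label ↔ ℕ) (S : System) where

  open Inverse Label↔ℕ using (to; from; strictlyInverseˡ; strictlyInverseʳ)

  -- A sequent Γ ⊢ Δ is presented as one list, with ⊕ marking the members of Γ
  -- and ⊖ those of Δ.
  data Signed : Set where
    ⊕ ⊖ : SeqFormula Label ATM → Signed

  antecedent succedent : List Signed → List (SeqFormula Label ATM)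
  antecedent []        = []
  antecedent (⊕ F ∷ Σ) = F ∷ antecedent Σ
  antecedent (⊖ F ∷ Σ) = antecedent Σ
  succedent []        = []
  succedent (⊕ F ∷ Σ) = succedent Σ
  succedent (⊖ F ∷ Σ) = F ∷ succedent Σ

  ∈-antecedent : ∀ {F} Σ → ⊕ F ∈ Σ → F ∈ antecedent Σ
  ∈-antecedent (⊕ _ ∷ Σ) (here refl) = here refl
  ∈-antecedent (⊕ _ ∷ Σ) (there p)   = there (∈-antecedent Σ p)
  ∈-antecedent (⊖ _ ∷ Σ) (there p)   = ∈-antecedent Σ p

  ∈-succedent : ∀ {F} Σ → ⊖ F ∈ Σ → F ∈ succedent Σ
  ∈-succedent (⊖ _ ∷ Σ) (here refl) = here refl
  ∈-succedent (⊖ _ ∷ Σ) (there p)   = there (∈-succedent Σ p)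
  ∈-succedent (⊕ _ ∷ Σ) (there p)   = ∈-succedent Σ p

  Derivable : List Signed → Set
  Derivable Σ = antecedent Σ ⊢[ S ] succedent Σ

  ruleL : ∀ {F} Σ → ⊕ F ∈ Σ → F ∷ antecedent Σ ⊢[ S ] succedent Σ → Derivable Σ
  ruleL Σ p = contractL (∈-antecedent Σ p)

  ruleR : ∀ {F} Σ → ⊖ F ∈ Σ → antecedent Σ ⊢[ S ] F ∷ succedent Σ → Derivable Σ
  ruleR Σ p = contractR (∈-succedent Σ p)

  -- Freshness is stated as a threshold in the numbering of labels, so that bounds combine by
  -- maxima.
  #-bound : (F : SeqFormula Label ATM) → ∃ λ n → ∀ y → n ≤ to y → y # F
  #-bound (x ∶ A) = suc (to x) , λ { y x<y refl → 1+n≰n x<y }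
  #-bound (x —[ A ]→ z) = suc (to x) ⊔ suc (to z) , λ y b →
    (λ { refl → 1+n≰n (m⊔n≤o⇒m≤o (suc (to x)) (suc (to z)) b) }) ,
    (λ { refl → 1+n≰n (m⊔n≤o⇒n≤o (suc (to x)) (suc (to z)) b) })

  All-#-bound : (Γ : List (SeqFormula Label ATM)) → ∃ λ n → ∀ y → n ≤ to y → All (y #_) Γ
  All-#-bound [] = 0 , λ _ _ → []
  All-#-bound (F ∷ Γ) with #-bound F | All-#-bound Γ
  ... | m , p | n , q = m ⊔ n , λ y b → p y (m⊔n≤o⇒m≤o m n b) ∷ q y (m⊔n≤o⇒n≤o m n b)

  fresh : (Γ Δ : List (SeqFormula Label ATM)) → ∃ λ y → All (y #_) Γ × All (y #_) Δ
  fresh Γ Δ with All-#-bound Γ | All-#-bound Δ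
  ... | m , p | n , q = from (m ⊔ n) , p _ (bound (m≤m⊔n m n)) , q _ (bound (m≤n⊔m m n))
    where
    bound : ∀ {k l} → k ≤ l → k ≤ to (from l)
    bound {l = l} k≤l = ≤-trans k≤l (≤-reflexive (sym (strictlyInverseˡ l)))

  -- Saturation conditions and one-step extensions.

  -- The label y is the instance at which ⊕ (x ∶ (A ⇒ B)) is required to be
  -- saturated; the other clauses ignore it.
  Saturated : Signed → Label → U.Pred Signed 0ℓ → Set
  Saturated (⊕ (x ∶ (A ⊃ B)))   y H = H (⊖ (x ∶ A)) ⊎ H (⊕ (x ∶ B))
  Saturated (⊖ (x ∶ (A ⊃ B)))   y H = H (⊕ (x ∶ A)) × H (⊖ (x ∶ B))
  Saturated (⊕ (x ∶ (A ⇒ B)))   y H = H (⊖ (x —[ A ]→ y)) ⊎ H (⊕ (y ∶ B))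
  Saturated (⊖ (x ∶ (A ⇒ B)))   y H = ∃ λ z → H (⊕ (x —[ A ]→ z)) × H (⊖ (z ∶ B))
  Saturated (⊕ (x —[ A ]→ z))   y H = T (hasID S) → H (⊕ (z ∶ A))
  Saturated (⊖ (x —[ A ]→ z))   y H = T (hasMP S) → x ≡ z → H (⊖ (x ∶ A))
  Saturated (⊕ (x ∶ atom P))    y H = ⊤
  Saturated (⊖ (x ∶ atom P))    y H = ⊤
  Saturated (⊕ (x ∶ ⊥′))        y H = ⊤
  Saturated (⊖ (x ∶ ⊥′))        y H = ⊤

  -- `H` occurs only positively in each clause, so a condition met at one stage persists at all
  -- later ones.
  Saturated-mono : ∀ σ {y} {H K : U.Pred Signed 0ℓ} → H U.⊆ K → Saturated σ y H → Saturated σ y K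
  Saturated-mono (⊕ (x ∶ (A ⊃ B))) H⊆K = Sum.map H⊆K H⊆K
  Saturated-mono (⊖ (x ∶ (A ⊃ B))) H⊆K (p , q) = H⊆K p , H⊆K q
  Saturated-mono (⊕ (x ∶ (A ⇒ B))) H⊆K = Sum.map H⊆K H⊆K
  Saturated-mono (⊖ (x ∶ (A ⇒ B))) H⊆K (z , p , q) = z , H⊆K p , H⊆K q
  Saturated-mono (⊕ (x —[ A ]→ z)) H⊆K s = H⊆K ∘ s
  Saturated-mono (⊖ (x —[ A ]→ z)) H⊆K s hasmp = H⊆K ∘ s hasmp
  Saturated-mono (⊕ (x ∶ atom P))  H⊆K _ = tt
  Saturated-mono (⊖ (x ∶ atom P))  H⊆K _ = tt
  Saturated-mono (⊕ (x ∶ ⊥′))      H⊆K _ = tt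
  Saturated-mono (⊖ (x ∶ ⊥′))      H⊆K _ = tt

  Underivable : Set
  Underivable = ∃ λ Σ → ¬ Derivable Σ

  Extension : Underivable → (List Signed → Set) → Set
  Extension (Σ , _) P = ∃ λ (C : Underivable) → Σ ⊆ proj₁ C × P (proj₁ C)

  branch : ∀ {Σ} σ τ → ¬ (Derivable (σ ∷ Σ) × Derivable (τ ∷ Σ)) →
           ¬ Derivable (σ ∷ Σ) ⊎ ¬ Derivable (τ ∷ Σ)
  branch {Σ} σ τ n with em {Derivable (σ ∷ Σ)}
  ... | yes d = inj₂ λ e → n (d , e)
  ... | no ¬d = inj₁ ¬d

  extend-⊎ : ∀ C σ τ → ¬ (Derivable (σ ∷ proj₁ C) × Derivable (τ ∷ proj₁ C)) →
             Extension C λ Σ → σ ∈ Σ ⊎ τ ∈ Σ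
  extend-⊎ (Σ , _) σ τ n with branch σ τ n
  ... | inj₁ u = (σ ∷ Σ , u) , there , inj₁ (here refl)
  ... | inj₂ u = (τ ∷ Σ , u) , there , inj₂ (here refl)

  saturate : ∀ C σ y → σ ∈ proj₁ C → Extension C λ Σ → Saturated σ y (_∈ Σ)
  saturate C@(Σ , u) (⊕ (x ∶ (A ⊃ B))) y p =
    extend-⊎ C _ _ λ (d , e) → u (ruleL Σ p (⊃L d e))
  saturate (Σ , u) (⊖ (x ∶ (A ⊃ B))) y p =
    (⊕ (x ∶ A) ∷ ⊖ (x ∶ B) ∷ Σ , λ d → u (ruleR Σ p (⊃R d))) ,
    there ∘ there , here refl , there (here refl)
  saturate C@(Σ , u) (⊕ (x ∶ (A ⇒ B))) y p =
    extend-⊎ C _ _ λ (d , e) → u (ruleL Σ p (⇒L d e))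
  saturate (Σ , u) (⊖ (x ∶ (A ⇒ B))) y p with fresh (antecedent Σ) (succedent Σ)
  ... | z , z#Γ , z#Δ =
    (⊕ (x —[ A ]→ z) ∷ ⊖ (z ∶ B) ∷ Σ ,
      -- The side condition `z ≢ x` is freshness of `z` for the principal formula, which is kept in
      -- the succedent.
      λ d → u (ruleR Σ p (⇒R z#Γ z#Δ (All.lookup {P = z #_} z#Δ (∈-succedent Σ p)) d))) ,
    there ∘ there , z , here refl , there (here refl)
  saturate C@(Σ , u) (⊕ (x —[ A ]→ z)) y p with em {T (hasID S)}
  ... | yes hasid =
    (⊕ (z ∶ A) ∷ Σ , λ d → u (ruleL Σ p (IDrule hasid d))) , there , λ _ → here refl
  ... | no ¬hasid = C , id , λ hasid → contradiction hasid ¬hasid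
  saturate C@(Σ , u) (⊖ (x —[ A ]→ z)) y p with em {T (hasMP S) × x ≡ z}
  ... | yes (hasmp , refl) =
    (⊖ (x ∶ A) ∷ Σ , λ d → u (ruleR Σ p (MPrule hasmp d))) , there , λ _ _ → here refl
  ... | no n = C , id , λ hasmp eq → contradiction (hasmp , eq) n
  saturate C (⊕ (x ∶ atom P)) y p = C , id , tt
  saturate C (⊖ (x ∶ atom P)) y p = C , id , tt
  saturate C (⊕ (x ∶ ⊥′))     y p = C , id , tt
  saturate C (⊖ (x ∶ ⊥′))     y p = C , id , tt

  -- The ω-step construction and its limit.

  Task : Set
  Task = Signed × Label

  Done : List Signed → Task → Set
  Done Σ (σ , y) = Saturated σ y (_∈ Σ)

  saturateAll : ∀ C (ts : List Task) → All (λ t → proj₁ t ∈ proj₁ C) ts →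
                Extension C λ Σ → All (Done Σ) ts
  saturateAll C [] [] = C , id , []
  saturateAll C ((σ , y) ∷ ts) (p ∷ ps) with saturate C σ y p
  ... | D , C⊆D , s with saturateAll D ts (All.map C⊆D ps)
  ... | E , D⊆E , ss = E , D⊆E ∘ C⊆D , Saturated-mono σ D⊆E s ∷ ss

  -- A stage can treat only finitely many labels; letting their number grow with the stage reaches
  -- every pair of a formula and a label.
  tasks : ℕ → List Signed → List Task
  tasks n Σ = cartesianProduct Σ (map from (upTo n))

  stage-step : ∀ n C → Extension C λ Σ → All (Done Σ) (tasks n (proj₁ C))
  stage-step n C = saturateAll C (tasks n (proj₁ C))
    (All.tabulate λ t∈ → proj₁ (∈-cartesianProduct⁻ (proj₁ C) (map from (upTo n)) t∈))

  stage : Underivable → ℕ → Underivable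
  stage C zero    = C
  stage C (suc n) = proj₁ (stage-step n (stage C n))

  stage-mono′ : ∀ C {m n} → m ≤′ n → proj₁ (stage C m) ⊆ proj₁ (stage C n)
  stage-mono′ C ≤′-refl = id
  stage-mono′ C (≤′-step {n} p) = proj₁ (proj₂ (stage-step n (stage C n))) ∘ stage-mono′ C p

  stage-mono : ∀ C {m n} → m ≤ n → proj₁ (stage C m) ⊆ proj₁ (stage C n)
  stage-mono C = stage-mono′ C ∘ ≤⇒≤′

  Limit : Underivable → U.Pred Signed 0ℓ
  Limit C σ = ∃ λ n → σ ∈ proj₁ (stage C n)

  ⊆-Limit : ∀ C {σ} → σ ∈ proj₁ C → Limit C σ
  ⊆-Limit C p = 0 , p

  Limit-saturated : ∀ C {σ} y → Limit C σ → Saturated σ y (Limit C)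
  Limit-saturated C {σ} y (m , p) =
    Saturated-mono σ (λ q → suc k , q)
      (All.lookup (proj₂ (proj₂ (stage-step k (stage C k))))
        (∈-cartesianProduct⁺ (stage-mono C (m≤m⊔n m (suc (to y))) p) y∈))
    where
    -- At stage `k` the formula `σ` is already present and `y` is among the first `k` labels; `suc`
    -- is needed because `upTo k` omits `k`.
    k : ℕ
    k = m ⊔ suc (to y)

    y∈ : y ∈ map from (upTo k)
    y∈ = subst (_∈ map from (upTo k)) (strictlyInverseʳ y)
           (∈-map⁺ from (∈-upTo⁺ (m≤n⊔m m (suc (to y)))))

  Limit-consistentL : ∀ C {F} → Limit C (⊕ F) → ¬ (F ∷ [] ⊢[ S ] [])
  Limit-consistentL C (n , p) d with stage C n
  ... | Σ , u = u (⊢-⊆ (λ { (here refl) → ∈-antecedent Σ p }) (λ ()) d)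

  -- Both formulas already lie in one finite stage, which weakening would make derivable.
  Limit-consistent : ∀ C {F G} → Limit C (⊕ F) → Limit C (⊖ G) → ¬ (F ∷ [] ⊢[ S ] G ∷ [])
  Limit-consistent C (m , p) (n , q) d
    with stage C (m ⊔ n) | stage-mono C (m≤m⊔n m n) | stage-mono C (m≤n⊔m m n)
  ... | Σ , u | m⊆ | n⊆ =
    u (⊢-⊆ (λ { (here refl) → ∈-antecedent Σ (m⊆ p) })
           (λ { (here refl) → ∈-succedent Σ (n⊆ q) }) d)

  -- The canonical model.

  World : Set
  World = Underivable × Label

  -- The syntactic counterpart of X = ⟦ A ⟧.  Using it in place of ⟦ A ⟧ makes the
  -- selection function independent of the truth lemma, where the formula on a
  -- transition may be larger than the one under induction.
  Represents : Formula ATM → U.Pred World 0ℓ → Set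
  Represents A X = ∀ C x → (Limit C (⊕ (x ∶ A)) → X (C , x)) × (Limit C (⊖ (x ∶ A)) → ¬ X (C , x))

  Represents-resp : ∀ {A X Y} → X U.≐ Y → Represents A X → Represents A Y
  Represents-resp (X⊆Y , Y⊆X) r C x = X⊆Y ∘ proj₁ (r C x) , λ p → proj₂ (r C x) p ∘ Y⊆X

  Represents-⊢ : ∀ {A B X} u → Represents A X → Represents B X → u ∶ A ∷ [] ⊢[ S ] u ∶ B ∷ []
  Represents-⊢ {A} {B} u rA rB = decidable-stable em λ n →
    let C = ⊕ (u ∶ A) ∷ ⊖ (u ∶ B) ∷ [] , n in
    proj₂ (rB C u) (⊆-Limit C (there (here refl))) (proj₁ (rA C u) (⊆-Limit C (here refl)))

  -- The MP rule read bottom-up acts on the succedent only and never puts a loop into the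
  -- antecedent, so `reflexive` adds the loops that the MP condition demands.
  data Selected (X : U.Pred World 0ℓ) : World → U.Pred World 0ℓ where
    transition : ∀ {C x y A} → Limit C (⊕ (x —[ A ]→ y)) → Represents A X → Selected X (C , x) (C , y)
    reflexive  : ∀ {w} → T (hasMP S) → X w → Selected X w w

  Selected-resp : ∀ {w X Y} → X U.≐ Y → Selected X w U.⊆ Selected Y w
  Selected-resp X≐Y (transition t r)  = transition t (Represents-resp X≐Y r)
  Selected-resp X≐Y (reflexive hasmp p) = reflexive hasmp (proj₁ X≐Y p)

  canonical : World → Model ATM
  canonical w = record
    { W        = World
    ; nonempty = w
    ; f        = λ w X → Selected X w
    ; f-cong   = λ w (X⊆Y , Y⊆X) → Selected-resp (X⊆Y , Y⊆X) , Selected-resp (Y⊆X , X⊆Y)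
    ; val      = λ { P (C , x) → Limit C (⊕ (x ∶ atom P)) }
    }

  -- Saturation under the ID rule puts `y ∶ A` into the antecedent, and `A` represents `X`; a loop
  -- exists only at members of `X`.
  Selected-ID : T (hasID S) → ∀ {X w} → Selected X w U.⊆ X
  Selected-ID hasid (transition {C} {y = y} t r) = proj₁ (r C y) (Limit-saturated C y t hasid)
  Selected-ID hasid (reflexive _ p) = p

  canonical-isModel : ∀ w → IsModelOf S (canonical w)
  canonical-isModel w = (λ hasid _ _ → Selected-ID hasid) , (λ hasmp _ _ → reflexive hasmp)

  -- The truth lemma.

  module _ (w₀ : World) where

    open Model (canonical w₀) using (⟦_⟧)

    -- Induction on `A`. The two signs are treated separately because a limit need not decide every
    -- labelled formula.
    ⟦⟧-represented : ∀ A → Represents A ⟦ A ⟧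
    ⟦⟧-represented (atom P) C x = id , λ q p → Limit-consistent C p q AX
    ⟦⟧-represented ⊥′ C x = (λ p → Limit-consistentL C p A⊥) , λ _ ()
    ⟦⟧-represented (A ⊃ B) C x = verify , refute
      where
      verify : Limit C (⊕ (x ∶ (A ⊃ B))) → ⟦ A ⊃ B ⟧ (C , x)
      verify p = Sum.map (proj₂ (⟦⟧-represented A C x)) (proj₁ (⟦⟧-represented B C x))
                   (Limit-saturated C x p)

      refute : Limit C (⊖ (x ∶ (A ⊃ B))) → ¬ ⟦ A ⊃ B ⟧ (C , x)
      refute p with Limit-saturated C x p
      ... | a , b = [ (λ ¬a → ¬a (proj₁ (⟦⟧-represented A C x) a))
                    , proj₂ (⟦⟧-represented B C x) b ]′
    ⟦⟧-represented (A ⇒ B) C x = verify , refute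
      where
      verify : Limit C (⊕ (x ∶ (A ⇒ B))) → ⟦ A ⇒ B ⟧ (C , x)
      verify p (transition {y = y} t r) with Limit-saturated C y p
      -- The transition `t` may carry a formula other than `A`, but both represent `⟦ A ⟧`, so (EQ)
      -- derives a sequent with `t` on the left and `q` on the right.
      ... | inj₁ q = contradiction
              (EQ {u = x} (Represents-⊢ x r (⟦⟧-represented A)) (Represents-⊢ x (⟦⟧-represented A) r))
              (Limit-consistent C t q)
      ... | inj₂ q = proj₁ (⟦⟧-represented B C y) q
      verify p (reflexive hasmp a) with Limit-saturated C x p
      ... | inj₁ q = contradiction a (proj₂ (⟦⟧-represented A C x) (Limit-saturated C x q hasmp refl))
      ... | inj₂ q = proj₁ (⟦⟧-represented B C x) q

      refute : Limit C (⊖ (x ∶ (A ⇒ B))) → ¬ ⟦ A ⇒ B ⟧ (C , x)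
      refute p A⇒B with Limit-saturated C x p
      ... | y , t , b = proj₂ (⟦⟧-represented B C y) b (A⇒B (transition t (⟦⟧-represented A)))

theorem3p8 : ExcludedMiddle 0ℓ →
    (ATM Label : Set) → Label ↔ ℕ →
    (S : System) (A : Formula ATM) → Valid S A →
    (x : Label) → [] ⊢[ S ] (x ∶ A ∷ [])
theorem3p8 em ATM Label Label↔ℕ S A valid x = decidable-stable em λ n →
  -- The sequent assumed underivable is the starting pair, and its own label `x` is the refuting
  -- world.
  let C = ⊖ (x ∶ A) ∷ [] , n
      w = C , x
  in proj₂ (⟦⟧-represented w A C x) (⊆-Limit C (here refl))
       (valid (canonical w) (canonical-isModel w) w)
  where open Canonical em Label↔ℕ S
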